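{- Let $G$ be a fuzzy automaton over the event set $E$, with generated fuzzy language $\mathcal{L}(G)$, and let $\mathcal{K}\subseteq\mathcal{L}(G)$ be a nonempty fuzzy language over $E$. Then there exist two local partially observable fuzzy supervisors $S_1$ and $S_2$ for $G$ such that $\mathcal{L}^{S_1\wedge S_2}=\mathcal{K}$ if and only if $\mathcal{K}$ is controllable (with respect to $\mathcal{L}(G)$ and $E_{uc}$) and co-observable (with respect to $\mathcal{L}(G)$, $P_i$, and $E_{ic}$, $i=1,2$).
   Context: $E$ is a finite set of events and $E^*$ is the set of all finite strings over $E$, including the empty string $\epsilon$. On $[0,1]$, $\wedge$ denotes infimum (minimum) and $\vee$ supremum (the supremum of the empty set is $0$). A fuzzy subset of a set $X$ is a function $X\to[0,1]$; $\mathcal{F}(X)$ is the set of all of them; $\mathcal{A}\subseteq\mathcal{B}$ means $\mathcal{A}(x)\le\mathcal{B}(x)$ for all $x$; $\mathrm{supp}(\mathcal{A})=\{x:\mathcal{A}(x)>0\}$. A fuzzy language over $E$ is an $\mathcal{A}\in\mathcal{F}(E^*)$ which is either the empty fuzzy language $\mathcal{O}$ (identically $0$), or satisfies $\mathcal{A}(\epsilon)=1$ and $\mathcal{A}(\mu)\ge\mathcal{A}(\mu\nu)$ for all $\mu,\nu\in E^*$. "Nonempty" means different from $\mathcal{O}$. A fuzzy automaton is $G=(Q,E,\delta,q_0)$ with $Q$ a (finite or infinite) set of states, $q_0\in Q$ the initial state, and $\delta:Q\times E\times Q\to[0,1]$. Extend $\delta$ to $Q\times E^*\times Q$ by $\delta(p,\epsilon,q)=1$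 if $q=p$ and $0$ otherwise, and $\delta(p,\omega a,q)=\vee_{r\in Q}(\delta(p,\omega,r)\wedge\delta(r,a,q))$. The generated fuzzy language is $\mathcal{L}(G)(\omega)=\vee_{q\in Q}\delta(q_0,\omega,q)$; it is a fuzzy language over $E$, that is, $\mathcal{L}(G)(\epsilon)=1$ and $\mathcal{L}(G)(\mu)\ge\mathcal{L}(G)(\mu\nu)$ for all $\mu,\nu\in E^*$. Write $\mathcal{L}=\mathcal{L}(G)$. The event set is partitioned as $E=E_c\,\dot\cup\,E_{uc}$ (controllable, uncontrollable) and as $E=E_o\,\dot\cup\,E_{uo}$ (observable, unobservable). There are local controllable event sets $E_{1c},E_{2c}\subseteq E_c$ with $E_{1c}\cup E_{2c}=E_c$ and local observable event sets $E_{1o},E_{2o}\subseteq E_o$ with $E_{1o}\cup E_{2o}=E_o$. For $i=1,2$, the natural projection $P_i:E^*\to E_{io}^*$ erases events not in $E_{io}$: $P_i(\epsilon)=\epsilon$, $P_i(sa)=P_i(s)P_i(a)$, with $P_i(a)=a$ if $a\in E_{io}$ and $P_i(a)=\epsilon$ otherwise. A local partially observable fuzzy supervisor $S_i$ ($i=1,2$) is a map $S_i:P_i[\mathrm{supp}(\mathcal{L}(G))]\to\mathcal{F}(E)$ with $S_i(t)(a)=1$ for all $t\in P_i[\mathrm{supp}(\mathcal{L}(G))]$ and $a\in E\setminus E_{ic}$. The fuzzy language $\mathcal{L}^{S_1\wedge S_2}$ generated under joint supervision is defined inductively by $\mathcal{L}^{S_1\wedge S_2}(\epsilon)=1$ and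 $\mathcal{L}^{S_1\wedge S_2}(sa)=\mathcal{L}(sa)\wedge\mathcal{L}^{S_1\wedge S_2}(s)\wedge S_1[P_1(s)](a)\wedge S_2[P_2(s)](a)$ for $s\in E^*$, $a\in E$ (where the right side is taken to be $0$ when $s\notin\mathrm{supp}(\mathcal{L})$, since then $\mathcal{L}(sa)=0$). A fuzzy language $\mathcal{K}\subseteq\mathcal{L}$ is controllable with respect to $\mathcal{L}$ and $E_{uc}$ if $\mathcal{K}(sa)=\mathcal{K}(s)\wedge\mathcal{L}(sa)$ for all $s\in E^*$ and $a\in E_{uc}$. It is co-observable (with respect to $\mathcal{L}$, $P_i$, $E_{ic}$, $i=1,2$) if for all $s\in\mathrm{supp}(\mathcal{K})$ and $a\in E_c=E_{1c}\cup E_{2c}$ the following hold, where the suprema range over all strings $s_i\in E^*$ with the indicated projection: (1) if $a\in E_{1c}\cap E_{2c}$, then $\mathcal{K}(sa)=\mathcal{K}(s)\wedge\mathcal{L}(sa)\wedge[\vee_{P_1(s_1)=P_1(s)}\mathcal{K}(s_1a)]\wedge[\vee_{P_2(s_2)=P_2(s)}\mathcal{K}(s_2a)]$; (2) if $a\in E_{1c}\setminus E_{2c}$, then $\mathcal{K}(sa)=\mathcal{K}(s)\wedge\mathcal{L}(sa)\wedge[\vee_{P_1(s_1)=P_1(s)}\mathcal{K}(s_1a)]$; (3) if $a\in E_{2c}\setminus E_{1c}$, then $\mathcal{K}(sa)=\mathcal{K}(s)\wedge\mathcal{L}(sa)\wedge[\vee_{P_2(s_2)=P_2(s)}\mathcal{K}(s_2a)]$.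 -}

module Defs where

open import Data.Fin.Base using (Fin)
open import Data.Fin.Subset as Subset using (Subset; _∈_; _∉_; _∪_; _∩_; _─_)
open import Data.Fin.Subset.Properties using (_∈?_)
open import Data.List.Base using (List; []; _∷_; _++_; filter)
open import Data.Nat.Base using (ℕ)
open import Data.Product.Base using (∃; _×_; _,_)
open import Data.Rational.Base as ℚ using (ℚ; 0ℚ; 1ℚ)
open import Data.Rational.Properties as ℚP using ()
open import Data.Sum.Base using (_⊎_; inj₁; inj₂)
open import Relation.Binary.PropositionalEquality.Core using (_≡_; refl; subst; sym)
open import Relation.Binary.Definitions using (tri<; tri≈; tri>)
open import Relation.Nullary.Negation.Core using (¬_)

-- The unit interval, as left Dedekind cuts: x is given by { q ∈ ℚ ∣ q < x },
-- a downward closed set of rationals without greatest element which contains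
-- every q < 0 and only q < 1. Locatedness is automatic classically, so these
-- are the real numbers in [0,1]. Constructively, requiring it would exclude
-- suprema of arbitrary families, which automata and co-observability use.

record 𝕀 : Set₁ where
  field
    Below      : ℚ → Set
    below-neg  : ∀ {q} → q ℚ.< 0ℚ → Below q
    below-one  : ∀ {q} → Below q → q ℚ.< 1ℚ
    below-down : ∀ {p q} → p ℚ.< q → Below q → Below p
    below-open : ∀ {q} → Below q → ∃ λ r → q ℚ.< r × Below r

open 𝕀 public

infix  4 _≤_ _<_ _≈_
infixr 7 _∧_

_≤_ : 𝕀 → 𝕀 → Set
x ≤ y = ∀ {q} → Below x q → Below y q

_≈_ : 𝕀 → 𝕀 → Set
x ≈ y = x ≤ y × y ≤ x

_<_ : 𝕀 → 𝕀 → Set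
x < y = ∃ λ q → ¬ Below x q × Below y q

private
  0<1 : 0ℚ ℚ.< 1ℚ
  0<1 = ℚP.positive⁻¹ 1ℚ

𝟙 : 𝕀
𝟙 = record
  { Below      = λ q → q ℚ.< 1ℚ
  ; below-neg  = λ q<0 → ℚP.<-trans q<0 0<1
  ; below-one  = λ q<1 → q<1
  ; below-down = ℚP.<-trans
  ; below-open = ℚP.<-dense
  }

_∧_ : 𝕀 → 𝕀 → 𝕀
x ∧ y = record
  { Below      = λ q → Below x q × Below y q
  ; below-neg  = λ q<0 → below-neg x q<0 , below-neg y q<0
  ; below-one  = λ (q∈x , _) → below-one x q∈x
  ; below-down = λ p<q (q∈x , q∈y) → below-down x p<q q∈x , below-down y p<q q∈y
  ; below-open = λ (q∈x , q∈y) → open∧ (below-open x q∈x) (below-open y q∈y)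
  }
  where
  open∧ : ∀ {q} →
          (∃ λ r → q ℚ.< r × Below x r) → (∃ λ r → q ℚ.< r × Below y r) →
          ∃ λ r → q ℚ.< r × (Below x r × Below y r)
  open∧ (r , q<r , r∈x) (r′ , q<r′ , r′∈y) with ℚP.<-cmp r r′
  ... | tri< r<r′ _ _ = r , q<r , r∈x , below-down y r<r′ r′∈y
  ... | tri≈ _ r≡r′ _ = r , q<r , r∈x , subst (Below y) (sym r≡r′) r′∈y
  ... | tri> _ _ r′<r = r′ , q<r′ , below-down x r′<r r∈x , r′∈y

-- The summand q < 0 makes the supremum of an empty family equal to 0.

⋁ : {I : Set} → (I → 𝕀) → 𝕀
⋁ f = record
  { Below      = λ q → q ℚ.< 0ℚ ⊎ ∃ λ i → Below (f i) q
  ; below-neg  = inj₁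
  ; below-one  = λ { (inj₁ q<0)       → ℚP.<-trans q<0 0<1
                   ; (inj₂ (i , q∈x)) → below-one (f i) q∈x }
  ; below-down = λ { p<q (inj₁ q<0)       → inj₁ (ℚP.<-trans p<q q<0)
                   ; p<q (inj₂ (i , q∈x)) → inj₂ (i , below-down (f i) p<q q∈x) }
  ; below-open = λ { (inj₁ q<0) →
                       let (r , q<r , r<0) = ℚP.<-dense q<0 in r , q<r , inj₁ r<0
                   ; (inj₂ (i , q∈x)) →
                       let (r , q<r , r∈x) = below-open (f i) q∈x
                       in r , q<r , inj₂ (i , r∈x) }
  }

𝟘 : 𝕀
𝟘 = record
  { Below      = λ q → q ℚ.< 0ℚ
  ; below-neg  = λ q<0 → q<0
  ; below-one  = λ q<0 → ℚP.<-trans q<0 0<1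
  ; below-down = ℚP.<-trans
  ; below-open = ℚP.<-dense
  }

𝓕 : Set → Set₁
𝓕 X = X → 𝕀

infix 4 _⊑_ _≐_

_⊑_ : {X : Set} → 𝓕 X → 𝓕 X → Set
A ⊑ B = ∀ x → A x ≤ B x

_≐_ : {X : Set} → 𝓕 X → 𝓕 X → Set
A ≐ B = ∀ x → A x ≈ B x

supp : {X : Set} → 𝓕 X → X → Set
supp A x = 𝟘 < A x

-- A string is stored with its last event at the head of the list, so that
-- recursion on lists is recursion along s ↦ sa.

Str : ℕ → Set
Str n = List (Fin n)

pattern ε = []

infixl 6 _·_
pattern _·_ s a = a ∷ s

infixl 6 _⌢_
_⌢_ : ∀ {n} → Str n → Str n → Str n
μ ⌢ ν = ν ++ μ

𝓞 : ∀ {n} → 𝓕 (Str n)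
𝓞 _ = 𝟘

IsFuzzyLanguage : ∀ {n} → 𝓕 (Str n) → Set
IsFuzzyLanguage A = A ≐ 𝓞 ⊎ (A ε ≈ 𝟙 × (∀ μ ν → A (μ ⌢ ν) ≤ A μ))

Nonempty : ∀ {n} → 𝓕 (Str n) → Set
Nonempty A = ¬ (A ≐ 𝓞)

record FuzzyAutomaton (n : ℕ) : Set₁ where
  field
    Q  : Set
    q₀ : Q
    δ  : Q → Fin n → Q → 𝕀

  -- The supremum of 𝟙 over the proofs of p ≡ q is 1 if q = p and 0 otherwise;
  -- no decision procedure for equality of states is needed.
  δ* : Q → Str n → Q → 𝕀
  δ* p ε       q = ⋁ {p ≡ q} λ _ → 𝟙
  δ* p (ω · a) q = ⋁ λ r → δ* p ω r ∧ δ r a q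

𝓛 : ∀ {n} → FuzzyAutomaton n → 𝓕 (Str n)
𝓛 G ω = ⋁ λ q → δ* q₀ ω q
  where open FuzzyAutomaton G

record EventSets (n : ℕ) : Set where
  field
    Ec Euc Eo Euo   : Subset n
    E₁c E₂c E₁o E₂o : Subset n
    c-cover    : Ec ∪ Euc ≡ Subset.⊤
    c-disjoint : Ec ∩ Euc ≡ Subset.⊥
    o-cover    : Eo ∪ Euo ≡ Subset.⊤
    o-disjoint : Eo ∩ Euo ≡ Subset.⊥
    -- These contain the inclusions Eᵢc ⊆ Ec and Eᵢo ⊆ Eo.
    c-local    : E₁c ∪ E₂c ≡ Ec
    o-local    : E₁o ∪ E₂o ≡ Eo

-- Strings over a subset of the events are represented as strings over all
-- events.

proj : ∀ {n} → Subset n → Str n → Str n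
proj Eio = filter (_∈? Eio)

-- t ∈ P [ A ] for A a set of strings.

Image : ∀ {n} → (Str n → Str n) → (Str n → Set) → Str n → Set
Image P A t = ∃ λ s → A s × P s ≡ t

-- A map on P[supp L] takes a string t and a proof that t lies in P[supp L];
-- `irrelevant` makes its values depend on t only.

record Supervisor {n} (L : 𝓕 (Str n)) (Eio Eic : Subset n) : Set₁ where
  field
    map        : (t : Str n) → Image (proj Eio) (supp L) t → 𝓕 (Fin n)
    irrelevant : ∀ {t} (m m′ : Image (proj Eio) (supp L) t) → map t m ≐ map t m′
    enabled    : ∀ {t} (m : Image (proj Eio) (supp L) t) {a} → a ∉ Eic → map t m a ≈ 𝟙

module _ {n} (Ev : EventSets n) where
  open EventSets Ev

  P₁ P₂ : Str n → Str n
  P₁ = proj E₁o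
  P₂ = proj E₂o

  Supervisor₁ Supervisor₂ : FuzzyAutomaton n → Set₁
  Supervisor₁ G = Supervisor (𝓛 G) E₁o E₁c
  Supervisor₂ G = Supervisor (𝓛 G) E₂o E₂c

  -- The supremum over the proofs of s ∈ supp 𝓛(G) gives the displayed meet when
  -- s ∈ supp 𝓛(G), and 0 otherwise.
  𝓛-joint : (G : FuzzyAutomaton n) → Supervisor₁ G → Supervisor₂ G → 𝓕 (Str n)
  𝓛-joint G S₁ S₂ ε       = 𝟙
  𝓛-joint G S₁ S₂ (s · a) = ⋁ {supp (𝓛 G) s} λ s∈ →
    𝓛 G (s · a) ∧ 𝓛-joint G S₁ S₂ s
      ∧ Supervisor.map S₁ (P₁ s) (s , s∈ , refl) a
      ∧ Supervisor.map S₂ (P₂ s) (s , s∈ , refl) a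

  Controllable : 𝓕 (Str n) → 𝓕 (Str n) → Set
  Controllable L K = ∀ s a → a ∈ Euc → K (s · a) ≈ K s ∧ L (s · a)

  sup-proj : (Str n → Str n) → 𝓕 (Str n) → Str n → Fin n → 𝕀
  sup-proj P K s a = ⋁ {∃ λ s′ → P s′ ≡ P s} λ (s′ , _) → K (s′ · a)

  CoObservable : 𝓕 (Str n) → 𝓕 (Str n) → Set
  CoObservable L K = ∀ s → supp K s → ∀ a → a ∈ Ec →
      (a ∈ E₁c ∩ E₂c →
         K (s · a) ≈ K s ∧ L (s · a) ∧ sup-proj P₁ K s a ∧ sup-proj P₂ K s a)
    × (a ∈ E₁c ─ E₂c →
         K (s · a) ≈ K s ∧ L (s · a) ∧ sup-proj P₁ K s a)
    × (a ∈ E₂c ─ E₁c →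
         K (s · a) ≈ K s ∧ L (s · a) ∧ sup-proj P₂ K s a)

{-# OPTIONS --safe #-}

-- Both sides are equivalent to K (s · a) being the meet of K s, L (s · a) and,
-- for each i, the value at a of the most restrictive supervisor whose language
-- can contain K: it enables a after t to the degree to which K allows a after
-- some string with projection t, and fully if a is not locally controllable.

module Submission where

open import Defs
open import Data.Bool.Base using (if_then_else_)
open import Data.Fin.Base using (Fin)
open import Data.Fin.Subset using (Subset; inside; outside; _∈_; _∉_; _─_)
open import Data.Fin.Subset.Properties
  using (_∈?_; ∈⊤; ∉⊥; x∈p∪q⁺; x∈p∪q⁻; x∈p∩q⁺; x∈p∩q⁻; x∈p∧x∉q⇒x∈p─q; p─q⊆p)
open import Data.Nat.Base using (ℕ)
open import Data.Product.Base using (∃; _×_; _,_; proj₁; proj₂)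
open import Data.Rational.Base as ℚ using (0ℚ)
open import Data.Rational.Properties using (_<?_)
open import Data.Sum.Base using (inj₁; inj₂; [_,_]′)
open import Data.Vec.Base using (_∷_; there)
open import Function.Bundles using (_⇔_; mk⇔)
open import Function.Base using (_∘_)
open import Relation.Binary.PropositionalEquality.Core using (_≡_; refl; sym; subst)
open import Relation.Nullary.Decidable.Core using (yes; no; does)
open import Relation.Nullary.Negation.Core using (¬_; contradiction)

private variable
  n : ℕ

x∈p─q⇒x∉q : ∀ (p q : Subset n) {x} → x ∈ p ─ q → x ∉ q
x∈p─q⇒x∉q (_ ∷ p) (outside ∷ q) (there x∈) (there x∈q) = x∈p─q⇒x∉q p q x∈ x∈q
x∈p─q⇒x∉q (_ ∷ p) (inside  ∷ q) (there x∈) (there x∈q) = x∈p─q⇒x∉q p q x∈ x∈q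

-- Only a rational q ≥ 0 below A x witnesses x ∈ supp A, hence the restriction.
≤-intro : ∀ x y → (∀ {q} → ¬ q ℚ.< 0ℚ → Below x q → Below y q) → x ≤ y
≤-intro x y f {q} q∈x with q <? 0ℚ
... | yes q<0 = below-neg y q<0
... | no  q≮0 = f q≮0 q∈x

⋁-elim : ∀ {I : Set} (f : I → 𝕀) {q} → ¬ q ℚ.< 0ℚ → Below (⋁ f) q → ∃ λ i → Below (f i) q
⋁-elim _ q≮0 = [ (λ q<0 → contradiction q<0 q≮0) , (λ i∈ → i∈) ]′

module _ (Eio Eic : Subset n) (K : 𝓕 (Str n)) where

  -- No proof that `t` is a projection enters, so irrelevance for `permitSupervisor` is immediate.
  -- At `t = proj Eio s` the supremum is `sup-proj` by definition.
  permit : Str n → 𝓕 (Fin n)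
  permit t a = if does (a ∈? Eic)
               then ⋁ {∃ λ s → proj Eio s ≡ t} (λ (s , _) → K (s · a))
               else 𝟙

  permit-∉ : ∀ {t a} → a ∉ Eic → permit t a ≈ 𝟙
  permit-∉ {a = a} a∉ with a ∈? Eic
  ... | yes a∈ = contradiction a∈ a∉
  ... | no  _  = (λ q → q) , (λ q → q)

  permit-∈ : ∀ {t a} → a ∈ Eic →
             permit t a ≈ ⋁ {∃ λ s → proj Eio s ≡ t} (λ (s , _) → K (s · a))
  permit-∈ {a = a} a∈ with a ∈? Eic
  ... | yes _  = (λ q → q) , (λ q → q)
  ... | no  a∉ = contradiction a∈ a∉

  K≤permit : ∀ s a → K (s · a) ≤ permit (proj Eio s) a
  K≤permit s a {q} q∈ with a ∈? Eic
  ... | yes _ = inj₂ ((s , refl) , q∈)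
  ... | no  _ = below-one (K (s · a)) q∈

  permitSupervisor : (L : 𝓕 (Str n)) → Supervisor L Eio Eic
  permitSupervisor L = record
    { map        = λ t _ → permit t
    ; irrelevant = λ _ _ _ → (λ q → q) , (λ q → q)
    ; enabled    = λ _ → permit-∉
    }

  module _ {L : 𝓕 (Str n)} (S : Supervisor L Eio Eic) where
    open Supervisor S

    -- A supervisor answers alike on strings with equal projections, so its value at `t` bounds
    -- `K (s · a)` for every `s` projecting to `t`, hence their supremum. The hypothesis also
    -- supplies `s∈`, as `map` needs a proof of membership.
    permit≤map :
      (∀ s a {q} → ¬ q ℚ.< 0ℚ → Below (K (s · a)) q →
        ∃ λ s∈ → Below (map (proj Eio s) (s , s∈ , refl) a) q) →
      ∀ {t} (m : Image (proj Eio) (supp L) t) a → permit t a ≤ map t m a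
    permit≤map K⇒map {t} m a with a ∈? Eic
    ... | no  a∉ = proj₂ (enabled m a∉)
    ... | yes _  = ≤-intro (⋁ K·a) (map t m a) λ q≮0 q∈ →
      let ((s , Ps≡t) , q∈K) = ⋁-elim K·a q≮0 q∈
          (s∈ , q∈map)       = K⇒map s a q≮0 q∈K
      in transport Ps≡t (s , s∈ , refl) q∈map
      where
      K·a : (∃ λ s → proj Eio s ≡ t) → 𝕀
      K·a (s , _) = K (s · a)

      -- With `t′` a variable the equation can be matched; `irrelevant` then reconciles the two
      -- membership proofs.
      transport : ∀ {t′ q} → t′ ≡ t → (m′ : Image (proj Eio) (supp L) t′) →
                  Below (map t′ m′ a) q → Below (map t m a) q
      transport refl m′ = proj₁ (irrelevant m′ m a)

module _ (Ev : EventSets n) (L K : 𝓕 (Str n)) where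
  open EventSets Ev

  permit₁ permit₂ : Str n → 𝓕 (Fin n)
  permit₁ = permit E₁o E₁c K
  permit₂ = permit E₂o E₂c K

  -- Only this half is recorded: the converse inequality follows from `K≤permit` once `K ⊑ L` and
  -- `K` decreases along strings.
  PermitBounded : Set
  PermitBounded = ∀ s a →
    K s ∧ L (s · a) ∧ permit₁ (P₁ Ev s) a ∧ permit₂ (P₂ Ev s) a ≤ K (s · a)

  E₁c⊆Ec : ∀ {a} → a ∈ E₁c → a ∈ Ec
  E₁c⊆Ec {a} a∈ = subst (a ∈_) c-local (x∈p∪q⁺ (inj₁ a∈))

  E₂c⊆Ec : ∀ {a} → a ∈ E₂c → a ∈ Ec
  E₂c⊆Ec {a} a∈ = subst (a ∈_) c-local (x∈p∪q⁺ (inj₂ a∈))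

  a∈Euc⇒a∉Ec : ∀ {a} → a ∈ Euc → a ∉ Ec
  a∈Euc⇒a∉Ec {a} a∈uc a∈c = ∉⊥ (subst (a ∈_) c-disjoint (x∈p∩q⁺ (a∈c , a∈uc)))

  a∉Eic⇒a∈Euc : ∀ {a} → a ∉ E₁c → a ∉ E₂c → a ∈ Euc
  a∉Eic⇒a∈Euc {a} a∉₁ a∉₂ with x∈p∪q⁻ Ec Euc (subst (a ∈_) (sym c-cover) ∈⊤)
  ... | inj₂ a∈uc = a∈uc
  ... | inj₁ a∈c  =
    [ (λ a∈₁ → contradiction a∈₁ a∉₁) , (λ a∈₂ → contradiction a∈₂ a∉₂) ]′
      (x∈p∪q⁻ E₁c E₂c (subst (a ∈_) (sym c-local) a∈c))

  -- Controllability handles the events that neither supervisor controls, and the three clauses of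
  -- co-observability the others; a permit outside its `Eic` is `𝟙` and drops out.
  bounded : Controllable Ev L K → CoObservable Ev L K → PermitBounded
  bounded ctrl coobs s a = ≤-intro
    (K s ∧ L (s · a) ∧ permit₁ (P₁ Ev s) a ∧ permit₂ (P₂ Ev s) a) (K (s · a)) go
    where
    go : ∀ {q} → ¬ q ℚ.< 0ℚ →
         Below (K s ∧ L (s · a) ∧ permit₁ (P₁ Ev s) a ∧ permit₂ (P₂ Ev s) a) q →
         Below (K (s · a)) q
    go {q} q≮0 (q∈K , q∈L , q∈₁ , q∈₂) with a ∈? E₁c | a ∈? E₂c
    ... | no a∉₁  | no a∉₂  = proj₂ (ctrl s a (a∉Eic⇒a∈Euc a∉₁ a∉₂)) (q∈K , q∈L)
    ... | yes a∈₁ | yes a∈₂ =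
      -- A rational `q ≥ 0` below `K s` witnesses that `s` is in the support of `K`.
      proj₂ (proj₁ (coobs s (q , q≮0 , q∈K) a (E₁c⊆Ec a∈₁)) (x∈p∩q⁺ (a∈₁ , a∈₂)))
        (q∈K , q∈L , q∈₁ , q∈₂)
    ... | yes a∈₁ | no a∉₂  =
      proj₂ (proj₁ (proj₂ (coobs s (q , q≮0 , q∈K) a (E₁c⊆Ec a∈₁))) (x∈p∧x∉q⇒x∈p─q a∈₁ a∉₂))
        (q∈K , q∈L , q∈₁)
    ... | no a∉₁  | yes a∈₂ =
      proj₂ (proj₂ (proj₂ (coobs s (q , q≮0 , q∈K) a (E₂c⊆Ec a∈₂))) (x∈p∧x∉q⇒x∈p─q a∈₂ a∉₁))
        (q∈K , q∈L , q∈₂)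

  module _ (K-step : ∀ s a → K (s · a) ≤ K s) (K⊑L : K ⊑ L) (bound : PermitBounded) where

    controllable : Controllable Ev L K
    controllable s a a∈uc =
        (λ q∈ → K-step s a q∈ , K⊑L (s · a) q∈)
      , λ (q∈K , q∈L) → bound s a
          ( q∈K , q∈L
          -- An uncontrollable event lies in neither local set, so both permits are `𝟙`; `q < 1`
          -- because `q` lies below `K s`.
          , proj₂ (permit-∉ E₁o E₁c K (a∈Euc⇒a∉Ec a∈uc ∘ E₁c⊆Ec)) (below-one (K s) q∈K)
          , proj₂ (permit-∉ E₂o E₂c K (a∈Euc⇒a∉Ec a∈uc ∘ E₂c⊆Ec)) (below-one (K s) q∈K))

    coObservable : CoObservable Ev L K
    coObservable s _ a _ =
        (λ a∈ → let (a∈₁ , a∈₂) = x∈p∩q⁻ E₁c E₂c a∈ in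
            -- The string `s` is itself an index of both suprema.
            (λ q∈ → K-step s a q∈ , K⊑L (s · a) q∈ , inj₂ ((s , refl) , q∈) , inj₂ ((s , refl) , q∈))
          , λ (q∈K , q∈L , q∈₁ , q∈₂) → bound s a
              (q∈K , q∈L , proj₂ (permit-∈ E₁o E₁c K a∈₁) q∈₁ , proj₂ (permit-∈ E₂o E₂c K a∈₂) q∈₂))
      , (λ a∈ →
            (λ q∈ → K-step s a q∈ , K⊑L (s · a) q∈ , inj₂ ((s , refl) , q∈))
          , λ (q∈K , q∈L , q∈₁) → bound s a
              ( q∈K , q∈L
              , proj₂ (permit-∈ E₁o E₁c K (p─q⊆p E₁c E₂c a∈)) q∈₁
              , proj₂ (permit-∉ E₂o E₂c K (x∈p─q⇒x∉q E₁c E₂c a∈)) (below-one (K s) q∈K)))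
      , (λ a∈ →
            (λ q∈ → K-step s a q∈ , K⊑L (s · a) q∈ , inj₂ ((s , refl) , q∈))
          , λ (q∈K , q∈L , q∈₂) → bound s a
              ( q∈K , q∈L
              , proj₂ (permit-∉ E₁o E₁c K (x∈p─q⇒x∉q E₂c E₁c a∈)) (below-one (K s) q∈K)
              , proj₂ (permit-∈ E₂o E₂c K (p─q⊆p E₂c E₁c a∈)) q∈₂))

module _ (Ev : EventSets n) (G : FuzzyAutomaton n) (K : 𝓕 (Str n))
         (K-step : ∀ s a → K (s · a) ≤ K s) (K⊑L : K ⊑ 𝓛 G) where
  open EventSets Ev

  -- Each supervisor dominates its permit, since the joint language is `K`; the meet with the
  -- permits therefore lies below the joint language.
  joint⇒bounded : ∀ S₁ S₂ → 𝓛-joint Ev G S₁ S₂ ≐ K → PermitBounded Ev (𝓛 G) K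
  joint⇒bounded S₁ S₂ J≐K s a = ≤-intro
    (K s ∧ 𝓛 G (s · a) ∧ permit₁ Ev (𝓛 G) K (P₁ Ev s) a ∧ permit₂ Ev (𝓛 G) K (P₂ Ev s) a)
    (K (s · a)) λ q≮0 (q∈K , q∈L , q∈₁ , q∈₂) →
    let s∈ = _ , q≮0 , K⊑L s q∈K in
    proj₁ (J≐K (s · a)) (inj₂
      ( s∈ , q∈L , proj₂ (J≐K s) q∈K
      , permit≤map E₁o E₁c K S₁
          (λ s′ a′ r≮0 r∈ → let (s′∈ , r∈₁ , _) = factors s′ a′ r≮0 r∈ in s′∈ , r∈₁)
          _ a q∈₁
      , permit≤map E₂o E₂c K S₂
          (λ s′ a′ r≮0 r∈ → let (s′∈ , _ , r∈₂) = factors s′ a′ r≮0 r∈ in s′∈ , r∈₂)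
          _ a q∈₂))
    where
    factors : ∀ s a {q} → ¬ q ℚ.< 0ℚ → Below (K (s · a)) q → ∃ λ (s∈ : supp (𝓛 G) s) →
      Below (Supervisor.map S₁ (P₁ Ev s) (s , s∈ , refl) a) q ×
      Below (Supervisor.map S₂ (P₂ Ev s) (s , s∈ , refl) a) q
    factors s a q≮0 q∈ with proj₂ (J≐K (s · a)) q∈
    ... | inj₁ q<0                      = contradiction q<0 q≮0
    ... | inj₂ (s∈ , _ , _ , q∈₁ , q∈₂) = s∈ , q∈₁ , q∈₂

  -- Induction on the string: the bound keeps the joint language below `K`, and `K≤permit` shows
  -- that the permits never cut into `K`.
  bounded⇒joint : K ε ≈ 𝟙 → PermitBounded Ev (𝓛 G) K →
    𝓛-joint Ev G (permitSupervisor E₁o E₁c K (𝓛 G)) (permitSupervisor E₂o E₂c K (𝓛 G)) ≐ K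
  bounded⇒joint (Kε≤𝟙 , 𝟙≤Kε) bound ε       = 𝟙≤Kε , Kε≤𝟙
  bounded⇒joint Kε≈𝟙 bound (s · a) =
      (λ { (inj₁ q<0) → below-neg (K (s · a)) q<0
         ; (inj₂ (_ , q∈L , q∈J , q∈₁ , q∈₂)) →
             bound s a (proj₁ (bounded⇒joint Kε≈𝟙 bound s) q∈J , q∈L , q∈₁ , q∈₂) })
    , ≤-intro (K (s · a)) (𝓛-joint Ev G _ _ (s · a)) λ q≮0 q∈ → inj₂
        ( (_ , q≮0 , K⊑L s (K-step s a q∈))
        , K⊑L (s · a) q∈
        , proj₂ (bounded⇒joint Kε≈𝟙 bound s) (K-step s a q∈)
        , K≤permit E₁o E₁c K s a q∈
        , K≤permit E₂o E₂c K s a q∈)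

theorem2 : (n : ℕ) (Ev : EventSets n) (G : FuzzyAutomaton n) (K : 𝓕 (Str n)) →
    IsFuzzyLanguage K → Nonempty K → K ⊑ 𝓛 G →
    (∃ λ (S₁ : Supervisor₁ Ev G) → ∃ λ (S₂ : Supervisor₂ Ev G) → 𝓛-joint Ev G S₁ S₂ ≐ K)
    ⇔ (Controllable Ev (𝓛 G) K × CoObservable Ev (𝓛 G) K)
theorem2 n Ev G K (inj₁ K≐𝓞) K≠𝓞 K⊑L = contradiction K≐𝓞 K≠𝓞
theorem2 n Ev G K (inj₂ (Kε≈𝟙 , K-prefix)) _ K⊑L = mk⇔
  (λ (S₁ , S₂ , J≐K) →
    let bound = joint⇒bounded Ev G K K-step K⊑L S₁ S₂ J≐K in
    controllable Ev (𝓛 G) K K-step K⊑L bound , coObservable Ev (𝓛 G) K K-step K⊑L bound)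
  (λ (ctrl , coobs) →
    -- The supervisors are inferred to be the two instances of `permitSupervisor`.
    _ , _ , bounded⇒joint Ev G K K-step K⊑L Kε≈𝟙 (bounded Ev (𝓛 G) K ctrl coobs))
  where
  K-step : ∀ s a → K (s · a) ≤ K s
  -- `s ⌢ (ε · a)` computes to `s · a`.
  K-step s a = K-prefix s (ε · a)
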